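{- For every integer $k \geq 2$ and every natural number $n \geq 4k-3$, there exists a $D(k)$ graph of order $n$ (i.e. with exactly $n$ vertices). Equivalently, the class $\mathcal{D}(k,n)$ of $D(k)$ graphs of order $n$ is nonempty.
   Context: All graphs are finite, simple and connected. $\gamma(G)$ denotes the domination number and $\chi(G)$ the chromatic number of $G$. A (proper) coloring of $G$ with $k$ colors is a partition $C=(V_1,\dots,V_k)$ of $V(G)$ into nonempty independent sets, called color classes. A vertex $u$ dominates the color class $V_i$ if $u$ is adjacent to every vertex of $V_i$, or if $V_i=\{u\}$. A dominator coloring of $G$ is a coloring in which every vertex dominates at least one color class; the dominator chromatic number $\chi_d(G)$ is the minimum number of colors in a dominator coloring of $G$. A graph $G$ is called a $D(k)$ graph if $\gamma(G)=\chi(G)=\chi_d(G)=k$. -}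

module Defs where

open import Data.Fin.Base using (Fin)
open import Data.Fin.Subset using (Subset; Nonempty; ⁅_⁆; ∣_∣; _∈_)
open import Data.Nat.Base using (ℕ; _≤_)
open import Data.Product using (Σ; ∃-syntax; ∃!; _×_)
open import Data.Sum.Base using (_⊎_)
open import Level using (0ℓ)
open import Relation.Binary.Construct.Closure.ReflexiveTransitive using (Star)
open import Relation.Binary.Core using (Rel)
open import Relation.Binary.Definitions using (Decidable; Irreflexive; Symmetric)
open import Relation.Binary.PropositionalEquality.Core using (_≡_)
open import Relation.Nullary.Negation.Core using (¬_)

-- The index n is the order; a graph of order n is represented on Fin n.
record Graph (n : ℕ) : Set₁ where
  field
    Adj       : Rel (Fin n) 0ℓ
    adj?      : Decidable Adj
    symmetric : Symmetric Adj
    loopless  : Irreflexive _≡_ Adj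
    connected : ∀ u v → Star Adj u v

IsMinimum : (ℕ → Set) → ℕ → Set
IsMinimum P k = P k × (∀ m → P m → k ≤ m)

module _ {n : ℕ} (G : Graph n) where
  open Graph G

  Dominating : Subset n → Set
  Dominating S = ∀ v → v ∈ S ⊎ (∃[ u ] u ∈ S × Adj u v)

  Independent : Subset n → Set
  Independent S = ∀ {u v} → u ∈ S → v ∈ S → ¬ Adj u v

  record Coloring (k : ℕ) : Set where
    field
      class       : Fin k → Subset n
      partition   : ∀ v → ∃! _≡_ (λ i → v ∈ class i)
      nonempty    : ∀ i → Nonempty (class i)
      independent : ∀ i → Independent (class i)

  DominatesClass : Fin n → Subset n → Set
  DominatesClass u V = (∀ {v} → v ∈ V → Adj u v) ⊎ V ≡ ⁅ u ⁆

  IsDominatorColoring : ∀ {k} → Coloring k → Set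
  IsDominatorColoring C = ∀ u → ∃[ i ] DominatesClass u (Coloring.class C i)

  -- The minima are stated as relations: "γ(G) = k", "χ(G) = k", "χ_d(G) = k".
  DominationNumber : ℕ → Set
  DominationNumber = IsMinimum (λ m → ∃[ S ] Dominating S × ∣ S ∣ ≡ m)

  ChromaticNumber : ℕ → Set
  ChromaticNumber = IsMinimum Coloring

  DominatorChromaticNumber : ℕ → Set
  DominatorChromaticNumber = IsMinimum (λ m → Σ (Coloring m) IsDominatorColoring)

  IsD : ℕ → Set
  IsD k = DominationNumber k × ChromaticNumber k × DominatorChromaticNumber k

{-# OPTIONS --safe #-}

-- Picking one vertex from each class of a dominator coloring gives a dominating set, and a k-clique
-- forces k colors; so it suffices to find a graph with a k-clique and a dominator coloring with k
-- classes in which every dominating set S has at least k elements.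
--
-- For even k the classes come in pairs (blocks). Each class has one clique vertex and at least two
-- main vertices; two opposite vertices of a block are adjacent when one of them is main, and all
-- clique vertices are adjacent. The main vertices of a block have no neighbours outside it, and no
-- single vertex dominates them all, so S has two vertices in each block. (For k = 2 the clique
-- vertex itself serves as a second main vertex, which gives K_{2,n-2}.) Further main vertices of one
-- class, the extra ones, bring the order up to n.
--
-- For odd k there is an extra hub, a class by itself, adjacent to the clique vertex of every other
-- class and to one new vertex dep in it. If S contains the hub, count as before. If not, then for
-- every class c the set S has a vertex near c: dep of c or a main vertex of the opposite class.
-- These are distinct for distinct c, and one more is needed: a vertex w of S dominates the hub, and
-- if w is the chosen vertex near its class c, so that it is dep of c, then the vertex of S
-- dominating the clique vertex of c is another one.

module Submission where

open import Defs
open import Data.Bool.Base using (true; Bool; false; not)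
open import Data.Bool.Properties using (not-involutive; ¬-not) renaming (_≟_ to _≟ᵇ_)
open import Data.Empty using () renaming (⊥ to Empty)
open import Data.Fin.Base using (Fin; zero; suc)
open import Data.Fin.Patterns using (0F; 1F; 2F; 3F)
open import Data.Fin.Properties
  using (_≟_; injective⇒≤; suc-injective; all?; ¬∀⟶∃¬; 2↔Bool; +↔⊎; *↔×)
open import Data.Fin.Subset using (Subset; inside; outside; _∈_; _∪_; _-_; ⊥; ⁅_⁆; ∣_∣)
open import Data.Fin.Subset.Properties
  using (_∈?_; x∈⁅x⁆; x∈⁅y⁆⇒x≡y; ⊆-antisym; ∣⊥∣≡0; ∣⁅x⁆∣≡1; p⊆p∪q; q⊆p∪q;
         x∈p∧x≢y⇒x∈p-y; x∈p⇒∣p-x∣<∣p∣)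
open import Data.Nat.Base using (ℕ; zero; suc; _+_; _≤_; z≤n; s≤s; _*_; _∸_; _≥_)
open import Data.Nat.Properties
  using (≤-reflexive; ≤-trans; ≤-antisym; +-mono-≤; +-monoʳ-≤; +-suc; n≤1+n; m≤m+n;
         m+n≤o⇒m≤o∸n; m≤n⇒∃[o]m+o≡n)
open import Data.Nat.Tactic.RingSolver using (solve-∀)
open import Data.Product.Base using (Σ; ∃-syntax; _×_; _,_; proj₁; proj₂)
open import Data.Product.Function.NonDependent.Propositional using (_×-↔_)
open import Data.Product.Properties using () renaming (≡-dec to ×-≡-dec)
open import Data.Sum.Base using (_⊎_; inj₁; inj₂; [_,_]′)
open import Data.Sum.Function.Propositional using (_⊎-↔_)
open import Data.Sum.Properties using () renaming (≡-dec to ⊎-≡-dec)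
open import Data.Vec.Base using ([]; _∷_; tabulate)
open import Data.Vec.Properties using (lookup⇒[]=; []=⇒lookup; lookup∘tabulate)
open import Function.Base using (_∘_; case_of_)
open import Function.Bundles using (_↔_; Inverse)
open import Function.Definitions using (Injective)
open import Function.Properties.Inverse using (↔-refl; ↔-trans)
open import Level using (0ℓ)
open import Relation.Binary.Construct.Closure.ReflexiveTransitive
  using (Star; reverse; ε; _◅_; _◅◅_)
open import Relation.Binary.Core using (Rel)
open import Relation.Binary.Definitions using (Decidable; Symmetric; DecidableEquality)
open import Relation.Binary.PropositionalEquality
  using (_≡_; _≢_; refl; sym; trans; cong; subst; subst₂; ≢-sym)
open import Relation.Nullary using (Dec; yes; no; does; contradiction; ¬_; ¬?; _×-dec_; _⊎-dec_)
open import Relation.Nullary.Decidable using (dec-true)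

-- Subsets of a finite set: comprehension, cardinality, images.

select : ∀ {n} {P : Fin n → Set} → (∀ v → Dec (P v)) → Subset n
select P? = tabulate (does ∘ P?)

module _ {n : ℕ} {P : Fin n → Set} (P? : ∀ v → Dec (P v)) where

  ∈-select⁺ : ∀ {v} → P v → v ∈ select P?
  ∈-select⁺ {v} p =
    lookup⇒[]= v (select P?) (trans (lookup∘tabulate (does ∘ P?) v) (dec-true (P? v) p))

  ∈-select⁻ : ∀ {v} → v ∈ select P? → P v
  ∈-select⁻ {v} v∈ with P? v | trans (sym (lookup∘tabulate (does ∘ P?) v)) ([]=⇒lookup v∈)
  ... | yes p | _ = p
  ... | no _  | ()

-- Induction on `k`: deleting `h zero` shrinks `S`, and injectivity keeps the other values in what
-- remains.
injective⇒≤∣∣ : ∀ {n k} {S : Subset n} {h : Fin k → Fin n} →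
                Injective _≡_ _≡_ h → (∀ i → h i ∈ S) → k ≤ ∣ S ∣
injective⇒≤∣∣ {k = zero}              _   _  = z≤n
injective⇒≤∣∣ {k = suc k} {S} {h} inj h∈ = ≤-trans
  (s≤s (injective⇒≤∣∣ {S = S - h zero} (suc-injective ∘ inj)
    (λ i → x∈p∧x≢y⇒x∈p-y (h∈ (suc i)) (λ eq → contradiction (inj eq) λ ()))))
  (x∈p⇒∣p-x∣<∣p∣ (h∈ zero))

∣p∪q∣≤∣p∣+∣q∣ : ∀ {n} (p q : Subset n) → ∣ p ∪ q ∣ ≤ ∣ p ∣ + ∣ q ∣
∣p∪q∣≤∣p∣+∣q∣ []      []      = z≤n
∣p∪q∣≤∣p∣+∣q∣ (outside ∷ p) (outside ∷ q) = ∣p∪q∣≤∣p∣+∣q∣ p q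
∣p∪q∣≤∣p∣+∣q∣ (outside ∷ p) (inside  ∷ q) =
  ≤-trans (s≤s (∣p∪q∣≤∣p∣+∣q∣ p q)) (≤-reflexive (sym (+-suc ∣ p ∣ ∣ q ∣)))
∣p∪q∣≤∣p∣+∣q∣ (inside  ∷ p) (outside ∷ q) = s≤s (∣p∪q∣≤∣p∣+∣q∣ p q)
∣p∪q∣≤∣p∣+∣q∣ (inside  ∷ p) (inside  ∷ q) =
  s≤s (≤-trans (∣p∪q∣≤∣p∣+∣q∣ p q) (+-monoʳ-≤ ∣ p ∣ (n≤1+n ∣ q ∣)))

image : ∀ {n k} → (Fin k → Fin n) → Subset n
image {k = zero}  f = ⊥
image {k = suc k} f = ⁅ f zero ⁆ ∪ image (f ∘ suc)

∈-image : ∀ {n k} (f : Fin k → Fin n) i → f i ∈ image f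
∈-image f zero    = p⊆p∪q _ (x∈⁅x⁆ (f zero))
∈-image f (suc i) = q⊆p∪q _ _ (∈-image (f ∘ suc) i)

-- Since `f` may repeat values, only an upper bound holds; for `rep`, equality will follow from the
-- lower bound on dominating sets.
∣image∣≤ : ∀ {n k} (f : Fin k → Fin n) → ∣ image f ∣ ≤ k
∣image∣≤ {n} {zero}  f = ≤-reflexive (∣⊥∣≡0 n)
∣image∣≤ {n} {suc k} f = ≤-trans (∣p∪q∣≤∣p∣+∣q∣ ⁅ f zero ⁆ _)
  (+-mono-≤ (≤-reflexive (∣⁅x⁆∣≡1 (f zero))) (∣image∣≤ (f ∘ suc)))

-- From a coloured clique-containing graph on arbitrary types to a D(k) graph on `Fin n`.

module Realisation
  {n k : ℕ} {V K : Set} (φ : Fin n ↔ V) (ψ : Fin k ↔ K)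
  (Adj : Rel V 0ℓ) (adj? : Decidable Adj) (symmetric : Symmetric Adj)
  (colour : V → K) (proper : ∀ {u v} → Adj u v → colour u ≢ colour v)
  (clique : K → V) (colour-clique : ∀ κ → colour (clique κ) ≡ κ)
  (clique-adj : ∀ {κ κ'} → κ ≢ κ' → Adj (clique κ) (clique κ'))
  (dominates : ∀ u → ∃[ κ ] ((∀ {v} → colour v ≡ κ → Adj u v) ⊎ (∀ {v} → colour v ≡ κ → v ≡ u)))
  -- The lower bound on the domination number: the colours inject into every decidable dominating
  -- set `P`. The vertex `h κ` need not have colour `κ`.
  (transversal : (P : V → Set) → (∀ v → Dec (P v)) → (∀ v → P v ⊎ (∃[ u ] P u × Adj u v)) →
                 ∃[ h ] Injective {A = K} _≡_ _≡_ h × (∀ κ → P (h κ)))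
  where

  open Inverse φ using ()
    renaming (to to ⟦_⟧; from to vertex; strictlyInverseˡ to ⟦vertex⟧; strictlyInverseʳ to vertex⟦⟧)
  open Inverse ψ using ()
    renaming (to to colourOf; from to index; strictlyInverseˡ to colourOf-index;
              strictlyInverseʳ to index-colourOf)

  vertex-injective : ∀ {u v} → vertex u ≡ vertex v → u ≡ v
  vertex-injective eq = trans (sym (⟦vertex⟧ _)) (trans (cong ⟦_⟧ eq) (⟦vertex⟧ _))

  colourOf-injective : ∀ {i j} → colourOf i ≡ colourOf j → i ≡ j
  colourOf-injective eq = trans (sym (index-colourOf _)) (trans (cong index eq) (index-colourOf _))

  _∼_ : Rel (Fin n) 0ℓ
  u ∼ v = Adj ⟦ u ⟧ ⟦ v ⟧

  col : Fin n → Fin k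
  col u = index (colour ⟦ u ⟧)

  rep : Fin k → Fin n
  rep i = vertex (clique (colourOf i))

  colour-of-index : ∀ {v κ} → col v ≡ index κ → colour ⟦ v ⟧ ≡ κ
  colour-of-index eq = trans (sym (colourOf-index _)) (trans (cong colourOf eq) (colourOf-index _))

  col-proper : ∀ {u v} → u ∼ v → col u ≢ col v
  col-proper u∼v eq = proper u∼v (colour-of-index eq)

  col-rep : ∀ i → col (rep i) ≡ i
  col-rep i = trans (cong (index ∘ colour) (⟦vertex⟧ _))
    (trans (cong index (colour-clique (colourOf i))) (index-colourOf i))

  rep-adj : ∀ {i j} → i ≢ j → rep i ∼ rep j
  rep-adj i≢j = subst₂ Adj (sym (⟦vertex⟧ _)) (sym (⟦vertex⟧ _))
    (clique-adj (i≢j ∘ colourOf-injective))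

  col-dominates : ∀ u → ∃[ i ] ((∀ {v} → col v ≡ i → u ∼ v) ⊎ (∀ {v} → col v ≡ i → v ≡ u))
  col-dominates u with dominates ⟦ u ⟧
  ... | κ , inj₁ f = index κ , inj₁ λ eq → f (colour-of-index eq)
  ... | κ , inj₂ f = index κ , inj₂ λ {v} eq →
    trans (sym (vertex⟦⟧ v)) (trans (cong vertex (f (colour-of-index eq))) (vertex⟦⟧ u))

  -- The class that `u` dominates contains its clique vertex. Both connectedness and the domination
  -- by `image rep` come from this.
  reaches-clique : ∀ u → ∃[ i ] (u ∼ rep i ⊎ rep i ≡ u)
  reaches-clique u with col-dominates u
  ... | i , inj₁ f = i , inj₁ (f (col-rep i))
  ... | i , inj₂ f = i , inj₂ (f (col-rep i))

  path-to-clique : ∀ u → ∃[ i ] Star _∼_ u (rep i)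
  path-to-clique u with reaches-clique u
  ... | i , inj₁ u∼rep  = i , u∼rep ◅ ε
  ... | i , inj₂ refl   = i , ε

  clique-path : ∀ i j → Star _∼_ (rep i) (rep j)
  clique-path i j with i ≟ j
  ... | yes refl = ε
  ... | no  i≢j  = rep-adj i≢j ◅ ε

  graph : Graph n
  graph = record
    { Adj       = _∼_
    ; adj?      = λ u v → adj? ⟦ u ⟧ ⟦ v ⟧
    ; symmetric = symmetric
    ; loopless  = λ { refl u∼u → col-proper u∼u refl }
    ; connected = λ u v → let i , p = path-to-clique u ; j , p' = path-to-clique v in
                          p ◅◅ clique-path i j ◅◅ reverse symmetric p'
    }

  dominating-bound : ∀ S → Dominating graph S → k ≤ ∣ S ∣
  dominating-bound S dom with transversal (λ v → vertex v ∈ S) (λ v → vertex v ∈? S) dom'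
    where
    dom' : ∀ v → vertex v ∈ S ⊎ (∃[ u ] vertex u ∈ S × Adj u v)
    dom' v with dom (vertex v)
    ... | inj₁ v∈S             = inj₁ v∈S
    ... | inj₂ (u , u∈S , u∼v) =
      inj₂ (⟦ u ⟧ , subst (_∈ S) (sym (vertex⟦⟧ u)) u∈S , subst (Adj ⟦ u ⟧) (⟦vertex⟧ v) u∼v)
  ... | h , h-inj , h∈S = injective⇒≤∣∣ {h = vertex ∘ h ∘ colourOf}
    (colourOf-injective ∘ h-inj ∘ vertex-injective) (h∈S ∘ colourOf)

  image-dominating : Dominating graph (image rep)
  image-dominating u with reaches-clique u
  ... | i , inj₁ u∼rep  = inj₂ (rep i , ∈-image rep i , symmetric u∼rep)
  ... | i , inj₂ refl   = inj₁ (∈-image rep i)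

  class? : ∀ i v → Dec (col v ≡ i)
  class? i v = col v ≟ i

  coloring : Coloring graph k
  coloring = record
    { class       = λ i → select (class? i)
    ; partition   = λ v → col v , ∈-select⁺ (class? (col v)) refl , λ {i} → ∈-select⁻ (class? i)
    ; nonempty    = λ i → rep i , ∈-select⁺ (class? i) (col-rep i)
    ; independent = λ i u∈ v∈ u∼v →
        col-proper u∼v (trans (∈-select⁻ (class? i) u∈) (sym (∈-select⁻ (class? i) v∈)))
    }

  coloring-dominator : IsDominatorColoring graph coloring
  coloring-dominator u with col-dominates u
  ... | i , inj₁ f = i , inj₁ (f ∘ ∈-select⁻ (class? i))
  ... | i , inj₂ f = i , inj₂ (⊆-antisym
    (λ v∈ → subst (_∈ ⁅ u ⁆) (sym (f (∈-select⁻ (class? i) v∈))) (x∈⁅x⁆ u))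
    -- The class contains `rep i`, which `f` identifies with `u`; hence `u` itself has colour `i`.
    (λ v∈ → ∈-select⁺ (class? i)
      (trans (cong col (trans (x∈⁅y⁆⇒x≡y u v∈) (sym (f (col-rep i))))) (col-rep i))))

  coloring-bound : ∀ m → Coloring graph m → k ≤ m
  coloring-bound m C = injective⇒≤ {f = λ i → proj₁ (partition (rep i))} λ {i} {j} → inj i j
    where
    open Coloring C
    inj : ∀ i j → proj₁ (partition (rep i)) ≡ proj₁ (partition (rep j)) → i ≡ j
    inj i j eq with i ≟ j
    ... | yes i≡j = i≡j
    ... | no  i≢j = contradiction (rep-adj i≢j) (independent _
      (proj₁ (proj₂ (partition (rep i))))
      (subst (λ l → rep j ∈ class l) (sym eq) (proj₁ (proj₂ (partition (rep j))))))

  isD : IsD graph k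
  isD = ((image rep , image-dominating ,
          ≤-antisym (∣image∣≤ rep) (dominating-bound _ image-dominating)) ,
         λ { _ (S , dom , refl) → dominating-bound S dom })
      , (coloring , coloring-bound)
      , ((coloring , coloring-dominator) , λ m → coloring-bound m ∘ proj₁)

-- The block construction.

data Tag : Set where
  clique dep main : Tag

_≟ᵗ_ : DecidableEquality Tag
clique ≟ᵗ clique = yes refl
clique ≟ᵗ dep    = no λ ()
clique ≟ᵗ main   = no λ ()
dep    ≟ᵗ clique = no λ ()
dep    ≟ᵗ dep    = yes refl
dep    ≟ᵗ main   = no λ ()
main   ≟ᵗ clique = no λ ()
main   ≟ᵗ dep    = no λ ()
main   ≟ᵗ main   = yes refl

-- There are `h` hubs and `suc m′` blocks of two sides; each side gets `t` vertices with roles given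
-- by `tag`. The number of blocks is positive so that block `zero` can hold the `e` extra vertices.
module Blocks (h m′ e : ℕ) {t : ℕ} (tag : Fin t → Tag) where

  m : ℕ
  m = suc m′

  Side : Set
  Side = Fin m × Bool

  opp : Side → Side
  opp (i , σ) = i , not σ

  opp-opp : ∀ c → opp (opp c) ≡ c
  opp-opp (i , σ) = cong (i ,_) (not-involutive σ)

  opp≢ : ∀ c → c ≢ opp c
  opp≢ (i , false) ()
  opp≢ (i , true)  ()

  opp-injective : ∀ {c d} → opp c ≡ opp d → c ≡ d
  opp-injective eq = trans (sym (opp-opp _)) (trans (cong opp eq) (opp-opp _))

  opp-swap : ∀ {c d} → d ≡ opp c → c ≡ opp d
  opp-swap eq = trans (sym (opp-opp _)) (cong opp (sym eq))

  -- Adjacency is defined on labels only, so vertices with equal labels have the same neighbours; an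
  -- extra vertex is just another copy of a main one.
  data Label : Set where
    hub : Fin h → Label
    at  : Side → Tag → Label

  at-injective : ∀ {c d s r} → at c s ≡ at d r → c ≡ d × s ≡ r
  at-injective refl = refl , refl

  infix 4 _~_

  _~_ : Rel Label 0ℓ
  hub _  ~ hub _  = Empty
  hub _  ~ at _ s = s ≢ main
  at _ s ~ hub _  = s ≢ main
  -- A `dep` label thus sees only hubs and the main label of the opposite side, while a main label
  -- sees everything on the opposite side and nothing else.
  at c s ~ at d r = (d ≡ opp c × (s ≡ main ⊎ r ≡ main)) ⊎ (c ≢ d × s ≡ clique × r ≡ clique)

  ~-dec : Decidable _~_
  ~-dec (hub _)  (hub _)  = no λ ()
  ~-dec (hub _)  (at _ s) = ¬? (s ≟ᵗ main)
  ~-dec (at _ s) (hub _)  = ¬? (s ≟ᵗ main)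
  ~-dec (at c s) (at d r) =
    ((d ≟ˢ opp c) ×-dec ((s ≟ᵗ main) ⊎-dec (r ≟ᵗ main)))
    ⊎-dec (¬? (c ≟ˢ d) ×-dec ((s ≟ᵗ clique) ×-dec (r ≟ᵗ clique)))
    where
    _≟ˢ_ : DecidableEquality Side
    _≟ˢ_ = ×-≡-dec _≟_ _≟ᵇ_

  ~-sym : Symmetric _~_
  ~-sym {hub _}  {at _ _} s≢main                    = s≢main
  ~-sym {at _ _} {hub _}  s≢main                    = s≢main
  ~-sym {at _ _} {at _ _} (inj₁ (eq , inj₁ s≡main)) = inj₁ (opp-swap eq , inj₂ s≡main)
  ~-sym {at _ _} {at _ _} (inj₁ (eq , inj₂ r≡main)) = inj₁ (opp-swap eq , inj₁ r≡main)
  ~-sym {at _ _} {at _ _} (inj₂ (c≢d , eq , eq′))   = inj₂ (≢-sym c≢d , eq′ , eq)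

  Class : Set
  Class = Fin h ⊎ Side

  class : Label → Class
  class (hub x)  = inj₁ x
  class (at c _) = inj₂ c

  V : Set
  V = (Fin h ⊎ (Side × Fin t)) ⊎ Fin e

  _≟ⱽ_ : DecidableEquality V
  _≟ⱽ_ = ⊎-≡-dec (⊎-≡-dec _≟_ (×-≡-dec (×-≡-dec _≟_ _≟ᵇ_) _≟_)) _≟_

  pattern hubᵛ x   = inj₁ (inj₁ x)
  pattern atᵛ c j  = inj₁ (inj₂ (c , j))
  pattern extraᵛ y = inj₂ y

  label : V → Label
  label (hubᵛ x)   = hub x
  label (atᵛ c j)  = at c (tag j)
  label (extraᵛ _) = at (zero , false) main

  colour : V → Class
  colour v = class (label v)

  Adj : Rel V 0ℓ
  Adj u v = label u ~ label v

  sides : Fin (m * 2) ↔ Side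
  sides = ↔-trans (*↔× {m}) (↔-refl ×-↔ 2↔Bool)

  vertices : Fin ((h + (m * 2) * t) + e) ↔ V
  vertices = ↔-trans (+↔⊎ {h + (m * 2) * t})
    (↔-trans (+↔⊎ {h}) (↔-refl ⊎-↔ ↔-trans (*↔× {m * 2}) (sides ×-↔ ↔-refl)) ⊎-↔ ↔-refl)

  classes : Fin (h + m * 2) ↔ Class
  classes = ↔-trans (+↔⊎ {h}) (↔-refl ⊎-↔ sides)

  proper : ∀ l l′ → l ~ l′ → class l ≢ class l′
  proper (hub _)  (at _ _) _                ()
  proper (at _ _) (hub _)  _                ()
  proper (at c _) (at _ _) (inj₁ (eq , _))  refl = opp≢ c eq
  proper (at _ _) (at _ _) (inj₂ (c≢c , _)) refl = c≢c refl

  -- Lower bound on dominating sets.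

  DominatedBy : (V → Set) → V → Set
  DominatedBy P v = P v ⊎ (∃[ u ] P u × Adj u v)

  -- Stated through neighbourhoods rather than tags, so that for `k = 2` a clique vertex can be one
  -- of the twins.
  Twins : Side → Set
  Twins c = ∃[ x ] ∃[ y ] x ≢ y × Twin x × Twin y
    where
    Twin : V → Set
    Twin x = colour x ≡ inj₂ c × (∀ u → Adj u x → colour u ≡ inj₂ (opp c))

  main-neighbour : ∀ {c} l → l ~ at c main → class l ≡ inj₂ (opp c)
  main-neighbour (hub _)  main≢main      = contradiction refl main≢main
  main-neighbour (at _ _) (inj₁ (eq , _)) = cong inj₂ (opp-swap eq)
  main-neighbour (at _ _) (inj₂ (_ , _ , ()))

  main-twins : ∀ {j j′} → j ≢ j′ → tag j ≡ main → tag j′ ≡ main → ∀ c → Twins c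
  main-twins {j} {j′} j≢j′ eq eq′ c =
    atᵛ c j , atᵛ c j′ , (λ { refl → j≢j′ refl }) , (refl , nbr j eq) , (refl , nbr j′ eq′)
    where
    nbr : ∀ i → tag i ≡ main → ∀ u → label u ~ at c (tag i) → colour u ≡ inj₂ (opp c)
    nbr i eq u u~ = main-neighbour (label u) (subst (λ s → label u ~ at c s) eq u~)

  InBlock : Fin m → V → Set
  InBlock i v = ∃[ σ ] colour v ≡ inj₂ (i , σ)

  inBlock-unique : ∀ {i i′ v} → InBlock i v → InBlock i′ v → i ≡ i′
  inBlock-unique (_ , eq) (_ , eq′) with trans (sym eq) eq′
  ... | refl = refl

  module _ {P : V → Set} (dominating : ∀ v → DominatedBy P v) where

    TwoInBlock : Fin m → Set
    TwoInBlock i = Σ (Bool → V) λ f → f false ≢ f true × (∀ σ → P (f σ) × InBlock i (f σ))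

    twoInBlock : ∀ {i u v} → u ≢ v → P u → InBlock i u → P v → InBlock i v → TwoInBlock i
    twoInBlock {u = u} {v} u≢v Pu iu Pv iv =
      (λ { false → u ; true → v }) , u≢v , λ { false → Pu , iu ; true → Pv , iv }

    -- A single vertex dominating both twins is on the opposite side.
    twins-dominated : ∀ c → Twins c →
                      TwoInBlock (proj₁ c) ⊎ (∃[ u ] P u × colour u ≡ inj₂ (opp c))
    twins-dominated (i , σ) (x , y , x≢y , (cx , nx) , (cy , ny)) with dominating x | dominating y
    ... | inj₂ (u , Pu , u~x) | _                    = inj₂ (u , Pu , nx u u~x)
    ... | inj₁ _              | inj₂ (u , Pu , u~y)  = inj₂ (u , Pu , ny u u~y)
    ... | inj₁ Px             | inj₁ Py              = inj₁ (twoInBlock x≢y Px (_ , cx) Py (_ , cy))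

    -- If neither side's twins already give two vertices, each side's twins have a dominator on the
    -- other side; these two lie on different sides, hence differ.
    two-in-block : (∀ c → Twins c) → ∀ i → TwoInBlock i
    two-in-block twins i
      with twins-dominated (i , false) (twins _) | twins-dominated (i , true) (twins _)
    ... | inj₁ two           | _             = two
    ... | inj₂ _             | inj₁ two      = two
    ... | inj₂ (u , Pu , cu) | inj₂ (v , Pv , cv) =
      twoInBlock (λ { refl → case trans (sym cu) cv of λ () }) Pu (_ , cu) Pv (_ , cv)

    -- The two classes of block `i` are sent to the two vertices found in that block, in either
    -- order of sides. Blocks are disjoint from each other and from the hubs, so injectivity is only
    -- at stake within a block.
    transversal-with-hubs : (∀ c → Twins c) → (∀ x → P (hubᵛ x)) →
                            ∃[ f ] Injective {A = Class} _≡_ _≡_ f × (∀ κ → P (f κ))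
    transversal-with-hubs twins Phub = f , injective , inP
      where
      two : ∀ i → TwoInBlock i
      two = two-in-block twins

      f : Class → V
      f (inj₁ x)       = hubᵛ x
      f (inj₂ (i , σ)) = proj₁ (two i) σ

      inP : ∀ κ → P (f κ)
      inP (inj₁ x)       = Phub x
      inP (inj₂ (i , σ)) = proj₁ (proj₂ (proj₂ (two i)) σ)

      inB : ∀ i σ → InBlock i (f (inj₂ (i , σ)))
      inB i σ = proj₂ (proj₂ (proj₂ (two i)) σ)

      hub∉block : ∀ {x i v} → InBlock i v → v ≢ hubᵛ x
      hub∉block (_ , ()) refl

      injective : Injective _≡_ _≡_ f
      injective {inj₁ _}       {inj₁ _}       refl = refl
      injective {inj₁ _}       {inj₂ (i , σ)} eq   = contradiction (sym eq) (hub∉block (inB i σ))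
      injective {inj₂ (i , σ)} {inj₁ _}       eq   = contradiction eq (hub∉block (inB i σ))
      injective {inj₂ (i , σ)} {inj₂ (j , τ)} eq
        with inBlock-unique (inB i σ) (subst (InBlock j) (sym eq) (inB j τ))
      injective {inj₂ (i , false)} {inj₂ (i , false)} eq | refl = refl
      injective {inj₂ (i , false)} {inj₂ (i , true)}  eq | refl =
        contradiction eq (proj₁ (proj₂ (two i)))
      injective {inj₂ (i , true)}  {inj₂ (i , false)} eq | refl =
        contradiction (sym eq) (proj₁ (proj₂ (two i)))
      injective {inj₂ (i , true)}  {inj₂ (i , true)}  eq | refl = refl

    -- Besides a hub, these are the only labels that a dominator of a `dep` vertex of side `c` can
    -- have.
    Near : Side → Label → Set
    Near c l = l ≡ at c dep ⊎ l ≡ at (opp c) main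

    -- The tag tells which alternative holds, and then the side determines `c`. So vertices chosen
    -- near distinct sides are distinct.
    near-unique : ∀ {c d l} → Near c l → Near d l → c ≡ d
    near-unique (inj₁ refl) (inj₁ refl) = refl
    near-unique (inj₂ refl) (inj₂ eq) = opp-injective (proj₁ (at-injective eq))

    module _ {x : Fin h} (hub-unique : (y z : Fin h) → y ≡ z) (¬Phub : ¬ P (hubᵛ x)) where

      not-hub : ∀ {u y} → P u → label u ≢ hub y
      not-hub {hubᵛ z} {y} Pu refl = ¬Phub (subst (P ∘ hubᵛ) (hub-unique z x) Pu)

      dep-dominator : ∀ {j} → tag j ≡ dep → ∀ c → ∃[ u ] P u × Near c (label u)
      dep-dominator {j} eq c with dominating (atᵛ c j)
      ... | inj₁ P-dep          = atᵛ c j , P-dep , inj₁ (cong (at c) eq)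
      ... | inj₂ (u , Pu , u~) = u , Pu , near (label u) refl (subst (λ s → label u ~ at c s) eq u~)
        where
        near : ∀ l → label u ≡ l → l ~ at c dep → Near c l
        near (hub y)  eq′ _                        = contradiction eq′ (not-hub Pu)
        near (at d _) _   (inj₁ (eq′ , inj₁ refl)) = inj₂ (cong (λ d → at d main) (opp-swap eq′))
        near (at d _) _   (inj₁ (eq′ , inj₂ ()))
        near (at d _) _   (inj₂ (_ , _ , ()))

      hub-dominator : ∃[ u ] P u × (∃[ c ] ∃[ s ] label u ≡ at c s × s ≢ main)
      hub-dominator with dominating (hubᵛ x)
      ... | inj₁ Phub          = contradiction Phub ¬Phub
      ... | inj₂ (u , Pu , u~) = u , Pu , go (label u) refl u~
        where
        go : ∀ l → label u ≡ l → l ~ hub x → ∃[ c ] ∃[ s ] label u ≡ at c s × s ≢ main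
        go (at c s) eq s≢main = c , s , eq , s≢main

      -- Neither outcome is a `dep` vertex, so this dominator differs from a `dep` vertex that
      -- dominates the hub.
      clique-dominator : ∀ {j} → tag j ≡ clique → ∀ c →
                         ∃[ u ] P u × (label u ≡ at (opp c) main ⊎ (∃[ d ] label u ≡ at d clique))
      clique-dominator {j} eq c with dominating (atᵛ c j)
      ... | inj₁ P-clique      = atᵛ c j , P-clique , inj₂ (c , cong (at c) eq)
      ... | inj₂ (u , Pu , u~) = u , Pu , go (label u) refl (subst (λ s → label u ~ at c s) eq u~)
        where
        go : ∀ l → label u ≡ l → l ~ at c clique → l ≡ at (opp c) main ⊎ (∃[ d ] l ≡ at d clique)
        go (hub y)  eq′ _                        = contradiction eq′ (not-hub Pu)
        go (at d _) _   (inj₁ (eq′ , inj₁ refl)) = inj₁ (cong (λ d → at d main) (opp-swap eq′))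
        go (at d _) _   (inj₁ (eq′ , inj₂ ()))
        go (at d _) _   (inj₂ (_ , refl , _))    = inj₂ (d , refl)

      transversal-without-hub : ∀ {j j′} → tag j ≡ dep → tag j′ ≡ clique →
                                ∃[ f ] Injective {A = Class} _≡_ _≡_ f × (∀ κ → P (f κ))
      transversal-without-hub dep-tag clique-tag = f , injective , inP
        where
        d : Side → V
        d c = proj₁ (dep-dominator dep-tag c)

        d-near : ∀ c → Near c (label (d c))
        d-near c = proj₂ (proj₂ (dep-dominator dep-tag c))

        fresh : ∃[ u ] P u × (∀ c → u ≢ d c)
        fresh with hub-dominator
        ... | w , Pw , c , s , w-at , s≢main with w ≟ⱽ d c
        -- A label on side `c` whose tag is not `main` can be near `c` only, so `w` need only be
        -- compared with `d c`.
        ...   | no w≢dc = w , Pw , λ { c′ refl → w≢dc (cong d (same (d-near c′) w-at)) }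
          where
          same : ∀ {c′ l} → Near c′ l → l ≡ at c s → c′ ≡ c
          same (inj₁ refl) refl = refl
          same (inj₂ refl) eq   = contradiction (sym (proj₂ (at-injective eq))) s≢main
        ...   | yes refl with clique-dominator clique-tag c
        -- Here `w` is `d c`. The label of `v` is near `c` alone, so `v ≡ d c′` would make `v` equal
        -- to `w`, whose tag is not `main`.
        ...     | v , Pv , inj₁ v-main = v , Pv , avoid
          where
          avoid : ∀ c′ → v ≢ d c′
          avoid c′ refl with near-unique {c′} (d-near c′) (inj₂ v-main)
          ... | refl = s≢main (sym (proj₂ (at-injective (trans (sym v-main) w-at))))
        -- A clique label is near no side at all.
        ...     | v , Pv , inj₂ (_ , v-clique) = v , Pv , λ { c′ refl → avoid (d-near c′) v-clique }
          where
          avoid : ∀ {c′ c″ l} → Near c′ l → l ≢ at c″ clique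
          avoid (inj₁ refl) ()
          avoid (inj₂ refl) ()

        f : Class → V
        f (inj₁ _) = proj₁ fresh
        f (inj₂ c) = d c

        inP : ∀ κ → P (f κ)
        inP (inj₁ _) = proj₁ (proj₂ fresh)
        inP (inj₂ c) = proj₁ (proj₂ (dep-dominator dep-tag c))

        injective : Injective _≡_ _≡_ f
        injective {inj₁ y} {inj₁ z}  _  = cong inj₁ (hub-unique y z)
        injective {inj₁ _} {inj₂ c}  eq = contradiction eq (proj₂ (proj₂ fresh) c)
        injective {inj₂ c} {inj₁ _}  eq = contradiction (sym eq) (proj₂ (proj₂ fresh) c)
        injective {inj₂ c} {inj₂ c′} eq =
          cong inj₂ (near-unique (d-near c) (subst (Near c′ ∘ label) (sym eq) (d-near c′)))

  -- The clique, the dominated classes and the resulting D(k) graph.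

  module _ (hub-unique : (y z : Fin h) → y ≡ z)
           {j₀ : Fin t} (clique-tag : tag j₀ ≡ clique)
           -- A `dep` vertex is not adjacent to the clique vertex of the opposite side and relies on
           -- the hub for a class to dominate; so `dep` tags may occur only together with a hub.
           (hub-or-no-dep : (Fin h × (∃[ j ] tag j ≡ dep)) ⊎ (¬ Fin h × (∀ j → tag j ≢ dep)))
           (twins : ∀ c → Twins c)
    where

    cliqueᵛ : Class → V
    cliqueᵛ (inj₁ x) = hubᵛ x
    cliqueᵛ (inj₂ c) = atᵛ c j₀

    colour-clique : ∀ κ → colour (cliqueᵛ κ) ≡ κ
    colour-clique (inj₁ _) = refl
    colour-clique (inj₂ _) = refl

    tag-j₀≢main : tag j₀ ≢ main
    tag-j₀≢main eq = case trans (sym clique-tag) eq of λ ()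

    clique-adj : ∀ {κ κ′} → κ ≢ κ′ → Adj (cliqueᵛ κ) (cliqueᵛ κ′)
    clique-adj {inj₁ x} {inj₁ y} κ≢κ′ = contradiction (cong inj₁ (hub-unique x y)) κ≢κ′
    clique-adj {inj₁ _} {inj₂ _} _    = tag-j₀≢main
    clique-adj {inj₂ _} {inj₁ _} _    = tag-j₀≢main
    clique-adj {inj₂ _} {inj₂ _} κ≢κ′ = inj₂ (κ≢κ′ ∘ cong inj₂ , clique-tag , clique-tag)

    dominates-main : ∀ c l → class l ≡ inj₂ (opp c) → at c main ~ l
    dominates-main c (at _ _) refl = inj₁ (refl , inj₁ refl)

    dominates-hub : ∀ {c s x} l → s ≢ main → class l ≡ inj₁ x → at c s ~ l
    dominates-hub (hub _) s≢main refl = s≢main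

    dominates-clique : (∀ j → tag j ≢ dep) → ∀ c v → class (label v) ≡ inj₂ (opp c) →
                       at c clique ~ label v
    dominates-clique no-dep c (atᵛ _ j) refl with tag j in eq
    ... | clique = inj₂ (opp≢ c , refl , refl)
    ... | dep    = contradiction eq (no-dep j)
    ... | main   = inj₁ (refl , inj₂ refl)
    dominates-clique no-dep c (extraᵛ _) eq = inj₁ (inj₂-injective eq , inj₂ refl)
      where
      inj₂-injective : ∀ {c d : Side} → inj₂ {A = Fin h} c ≡ inj₂ d → c ≡ d
      inj₂-injective refl = refl

    -- Main vertices dominate the opposite class. A clique vertex does so only in the absence of
    -- `dep` vertices; otherwise the hub is the class it dominates.
    dominates : ∀ u → ∃[ κ ] ((∀ {v} → colour v ≡ κ → Adj u v) ⊎ (∀ {v} → colour v ≡ κ → v ≡ u))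
    dominates (hubᵛ x) = inj₁ x , inj₂ λ { {hubᵛ _} refl → refl }
    dominates (atᵛ c j) with tag j in eq
    ... | main   = inj₂ (opp c) , inj₁ λ {v} → dominates-main c (label v)
    ... | dep    = [ (λ (x , _) → inj₁ x , inj₁ λ {v} → dominates-hub (label v) λ ())
                   , (λ (_ , no-dep) → contradiction eq (no-dep j)) ]′ hub-or-no-dep
    ... | clique = [ (λ (x , _) → inj₁ x , inj₁ λ {v} → dominates-hub (label v) λ ())
                   , (λ (_ , no-dep) → inj₂ (opp c) , inj₁ λ {v} → dominates-clique no-dep c v)
                   ]′ hub-or-no-dep
    dominates (extraᵛ _) = inj₂ _ , inj₁ λ {v} → dominates-main _ (label v)

    transversal : (P : V → Set) → (∀ v → Dec (P v)) → (∀ v → P v ⊎ (∃[ u ] P u × Adj u v)) →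
                  ∃[ f ] Injective {A = Class} _≡_ _≡_ f × (∀ κ → P (f κ))
    transversal P P? dominating with all? (P? ∘ hubᵛ)
    -- This case also covers the graphs without a hub, where the condition is vacuous.
    ... | yes Phub = transversal-with-hubs dominating twins Phub
    ... | no ¬Phubs =
      [ (λ (_ , _ , dep-tag) →
          transversal-without-hub dominating hub-unique (proj₂ missing) dep-tag clique-tag)
      , (λ (no-hub , _) → contradiction (proj₁ missing) no-hub)
      ]′ hub-or-no-dep
      where
      missing : ∃[ x ] ¬ P (hubᵛ x)
      missing = ¬∀⟶∃¬ h (P ∘ hubᵛ) (P? ∘ hubᵛ) ¬Phubs

    blocks-D : Σ (Graph ((h + (m * 2) * t) + e)) λ G → IsD G (h + m * 2)
    blocks-D = graph , isD
      where
      open Realisation vertices classes Adj (λ u v → ~-dec (label u) (label v))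
        (λ {u} {v} → ~-sym {label u} {label v}) colour (λ {u} {v} → proper (label u) (label v))
        cliqueᵛ colour-clique clique-adj dominates transversal
        using (graph; isD)

-- The three families of graphs and their orders.

two-D : ∀ e → Σ (Graph (4 + e)) λ G → IsD G 2
two-D e = blocks-D (λ ()) {0F} refl (inj₂ ((λ ()) , λ { 0F () ; 1F () })) twins
  where
  tag : Fin 2 → Tag
  tag 0F = clique
  tag 1F = main

  open Blocks 0 0 e tag

  -- With a single block, the only other side is the opposite one. This is what lets a clique vertex
  -- act as a twin, so that two vertices per side suffice.
  clique-neighbour : ∀ c l → l ~ at c clique → class l ≡ inj₂ (opp c)
  clique-neighbour _ (at _ _) (inj₁ (eq , _)) = cong inj₂ (opp-swap eq)
  clique-neighbour (0F , τ) (at (0F , σ) _) (inj₂ (c≢d , _)) =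
    cong (λ σ → inj₂ (0F , σ)) (¬-not λ { refl → c≢d refl })

  twins : ∀ c → Twins c
  twins c = atᵛ c 0F , atᵛ c 1F , (λ ()) ,
    (refl , λ u → clique-neighbour c (label u)) , (refl , λ u → main-neighbour (label u))

-- The smallest order `3k` is at most `4k - 3` once `k ≥ 3`; for `k = 2` it would be 6 against 5,
-- whence the separate `two-D`.
even-D : ∀ m e → Σ (Graph ((suc m * 2) * 3 + e)) λ G → IsD G (suc m * 2)
even-D m e = blocks-D (λ ()) {0F} refl (inj₂ ((λ ()) , λ { 0F () ; 1F () ; 2F () }))
  (main-twins {1F} {2F} (λ ()) refl refl)
  where
  tag : Fin 3 → Tag
  tag 0F = clique
  tag 1F = main
  tag 2F = main

  open Blocks 0 m e tag

-- The smallest order, `1 + 4(k - 1)`, is exactly the bound `4k - 3`.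
odd-D : ∀ m e → Σ (Graph ((1 + (suc m * 2) * 4) + e)) λ G → IsD G (1 + suc m * 2)
odd-D m e = blocks-D (λ { 0F 0F → refl }) {0F} refl (inj₁ (0F , 1F , refl))
  (main-twins {2F} {3F} (λ ()) refl refl)
  where
  tag : Fin 4 → Tag
  tag 0F = clique
  tag 1F = dep
  tag 2F = main
  tag 3F = main

  open Blocks 1 m e tag

parity : ∀ k → ∃[ m ] (k ≡ m * 2 ⊎ k ≡ 1 + m * 2)
parity zero    = 0 , inj₁ refl
parity (suc k) with parity k
... | m , inj₁ refl = m , inj₂ refl
... | m , inj₂ refl = suc m , inj₁ refl

fill : ∀ {k a n} → (∀ e → Σ (Graph (a + e)) λ G → IsD G k) → n ≥ a → Σ (Graph n) λ G → IsD G k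
fill D n≥a with m≤n⇒∃[o]m+o≡n n≥a
... | e , refl = D e

6m≤8m-3 : ∀ m → ((2 + m) * 2) * 3 ≤ 4 * ((2 + m) * 2) ∸ 3
6m≤8m-3 m = m+n≤o⇒m≤o∸n (((2 + m) * 2) * 3)
  (subst (((2 + m) * 2) * 3 + 3 ≤_) (sym (eq m)) (m≤m+n _ (1 + 2 * m)))
  where
  -- With `k = 2(2 + m)`, the slack `1 + 2 * m` is `k - 3`.
  eq : ∀ m → 4 * ((2 + m) * 2) ≡ ((2 + m) * 2) * 3 + 3 + (1 + 2 * m)
  eq = solve-∀

1+8m≤8m+4-3 : ∀ m → 1 + (suc m * 2) * 4 ≤ 4 * (1 + suc m * 2) ∸ 3
1+8m≤8m+4-3 m = m+n≤o⇒m≤o∸n (1 + (suc m * 2) * 4) (≤-reflexive (eq m))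
  where
  eq : ∀ m → 1 + (suc m * 2) * 4 + 3 ≡ 4 * (1 + suc m * 2)
  eq = solve-∀

theorem2 : (k : ℕ) → k ≥ 2 → (n : ℕ) → n ≥ 4 * k ∸ 3 → Σ (Graph n) (λ G → IsD G k)
theorem2 k k≥2 n n≥ with parity k
... | 0           , inj₁ refl = contradiction k≥2 λ ()
-- For `k = 2` the hypothesis gives `n ≥ 5`, whereas `two-D` already starts at order 4.
... | 1           , inj₁ refl = fill two-D (≤-trans (n≤1+n 4) n≥)
... | suc (suc m) , inj₁ refl = fill (even-D (suc m)) (≤-trans (6m≤8m-3 m) n≥)
... | 0           , inj₂ refl = contradiction k≥2 λ { (s≤s ()) }
... | suc m       , inj₂ refl = fill (odd-D m) (≤-trans (1+8m≤8m+4-3 m) n≥)
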